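{- Let $T_1$ and $T_2$ be trees of orders $m,n$ and diameters $d_1,d_2$, respectively, with $|W(T_1)|=|W(T_2)|=2$. Let $G=T_1\Box T_2$, $p=mn$, $d=d_1+d_2$. If ${\rm rn}(G)=(p-1)(d-1)-2nL(T_1)-2mL(T_2)+1$, then $T_1=T_2=P_2$.
   Context: All graphs are finite, simple and connected; $d(u,v)$ is the distance and ${\rm diam}(G)$ the diameter. A radio labeling of $G$ is a map $f:V(G)\to\mathbb{Z}_{\ge 0}$ with $|f(u)-f(v)|\geq {\rm diam}(G)+1-d(u,v)$ for all distinct $u,v$; its span is $\max f-\min f$, and ${\rm rn}(G)$ is the minimum span. For a tree $T$ and $v\in V(T)$, $w_T(v)=\sum_{u}d(u,v)$; weight centers are the minimizers of $w_T$ and $W(T)$ is their set. The level of $u$ is $L_T(u)=\min_{w\in W(T)}d(u,w)$ and $L(T)=\sum_{u\in V(T)}L_T(u)$. $T_1\Box T_2$ is the Cartesian product; $P_2$ is the path on two vertices. -}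

module Defs where

open import Data.Bool using (Bool; true; false; _∧_; _∨_; if_then_else_)
open import Data.Nat using (ℕ; zero; suc; _+_; _*_; _∸_; _≤_; _⊓_; _⊔_; ∣_-_∣; _≡ᵇ_)
open import Data.Fin using (Fin; zero; suc; inject₁; fromℕ; remQuot)
import Data.Fin as Fin
open import Data.List using (List; []; _∷_; foldr; map; filterᵇ; allFin)
open import Data.Product using (Σ; ∃; _×_; _,_; proj₁; proj₂)
open import Relation.Nullary using (¬_)
open import Relation.Nullary.Decidable using (⌊_⌋)
open import Relation.Binary.PropositionalEquality using (_≡_; _≢_)
open import Function.Definitions using (Injective)

Graph : ℕ → Set
Graph n = Fin n → Fin n → Bool

_==_ : ∀ {n} → Fin n → Fin n → Bool
i == j = ⌊ i Fin.≟ j ⌋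

sumF : ∀ {n} → (Fin n → ℕ) → ℕ
sumF {zero} f = 0
sumF {suc n} f = f zero + sumF (λ i → f (suc i))

maxF : ∀ {n} → (Fin n → ℕ) → ℕ
maxF {zero} f = 0
maxF {suc n} f = f zero ⊔ maxF (λ i → f (suc i))

minF : ∀ {n} → (Fin n → ℕ) → ℕ
minF {zero} f = 0
minF {suc zero} f = f zero
minF {suc (suc n)} f = f zero ⊓ minF (λ i → f (suc i))

minL : List ℕ → ℕ
minL [] = 0
minL (x ∷ xs) = foldr _⊓_ x xs

anyF : ∀ {n} → (Fin n → Bool) → Bool
anyF {zero} f = false
anyF {suc n} f = f zero ∨ anyF (λ i → f (suc i))

reach : ∀ {n} → Graph n → ℕ → Fin n → Fin n → Bool
reach G zero u v = u == v
reach G (suc k) u v = reach G k u v ∨ anyF (λ w → G u w ∧ reach G k w v)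

search : (ℕ → Bool) → ℕ → ℕ → ℕ
search p k zero = k
search p k (suc fuel) = if p k then k else search p (suc k) fuel

-- distance d(u,v): least length of a walk from u to v
-- (walks of length ≤ n-1 suffice in a connected graph on n vertices)
dist : ∀ {n} → Graph n → Fin n → Fin n → ℕ
dist {n} G u v = search (λ k → reach G k u v) 0 n

diam : ∀ {n} → Graph n → ℕ
diam G = maxF (λ u → maxF (λ v → dist G u v))

IsSimple : ∀ {n} → Graph n → Set
IsSimple G = (∀ u v → G u v ≡ G v u) × (∀ u → G u u ≡ false)

IsConnected : ∀ {n} → Graph n → Set
IsConnected G = ∀ u v → ∃ λ k → reach G k u v ≡ true

Cycle : ∀ {n} → Graph n → Set
Cycle {n} G = Σ ℕ λ j → Σ (Fin (suc (suc (suc j))) → Fin n) λ c →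
  Injective _≡_ _≡_ c
  × (∀ (i : Fin (suc (suc j))) → G (c (inject₁ i)) (c (suc i)) ≡ true)
  × (G (c (fromℕ (suc (suc j)))) (c zero) ≡ true)

IsTree : ∀ {n} → Graph n → Set
IsTree G = IsSimple G × IsConnected G × ¬ Cycle G

weight : ∀ {n} → Graph n → Fin n → ℕ
weight G v = sumF (λ u → dist G u v)

isWeightCenter : ∀ {n} → Graph n → Fin n → Bool
isWeightCenter G v = weight G v ≡ᵇ minF (weight G)

numWeightCenters : ∀ {n} → Graph n → ℕ
numWeightCenters G = sumF (λ v → if isWeightCenter G v then 1 else 0)

weightCenters : ∀ {n} → Graph n → List (Fin n)
weightCenters {n} G = filterᵇ (isWeightCenter G) (allFin n)

level : ∀ {n} → Graph n → Fin n → ℕ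
level G u = minL (map (dist G u) (weightCenters G))

totalLevel : ∀ {n} → Graph n → ℕ
totalLevel G = sumF (level G)

_□_ : ∀ {m n} → Graph m → Graph n → Graph (m * n)
_□_ {m} {n} G H x y with remQuot {m} n x | remQuot {m} n y
... | (a₁ , b₁) | (a₂ , b₂) = ((a₁ == a₂) ∧ H b₁ b₂) ∨ (G a₁ a₂ ∧ (b₁ == b₂))

IsRadioLabeling : ∀ {n} → Graph n → (Fin n → ℕ) → Set
IsRadioLabeling G f = ∀ u v → u ≢ v → diam G + 1 ∸ dist G u v ≤ ∣ f u - f v ∣

span : ∀ {n} → (Fin n → ℕ) → ℕ
span f = maxF f ∸ minF f

IsRadioNumber : ∀ {n} → Graph n → ℕ → Set
IsRadioNumber G k =
  (∃ λ f → IsRadioLabeling G f × span f ≡ k)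
  × (∀ f → IsRadioLabeling G f → k ≤ span f)

P₂ : Graph 2
P₂ u v = ¬b (u == v)
  where
  ¬b : Bool → Bool
  ¬b true = false
  ¬b false = true

Isomorphic : ∀ {m n} → Graph m → Graph n → Set
Isomorphic {m} {n} G H = Σ (Fin m → Fin n) λ φ → Σ (Fin n → Fin m) λ ψ →
  (∀ x → ψ (φ x) ≡ x) × (∀ y → φ (ψ y) ≡ y) × (∀ u v → H (φ u) (φ v) ≡ G u v)

{-# OPTIONS --safe #-}

-- The two weight centers of a tree are adjacent (the weight is strictly convex along paths), so they split
-- the vertices into two sides, and d(u,v) ≤ L(u) + L(v) + 1, without the 1 when u and v are on the same side.
-- List the vertices of G by increasing label.  The slack of a step from u to v is what f(v) - f(u) exceeds
-- d - 1 - L(u) - L(v) by; summing over all steps, the assumed span leaves a total of at most 1 for the slacks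
-- and the levels of the two end vertices.  A step of slack 0 switches sides in both coordinates, so it never
-- leaves {LL, RR} or {LR, RL}, and hence exactly one step has slack 1 and the end vertices have level 0.
-- Two consecutive steps of slack 0 force d ≥ 2L(v) + 3 at their common vertex v.  If d ≥ 3, every vertex
-- with d ≤ 2L(v) + 2 is therefore an end of the exceptional step.  Let x, y and z, w be diametral pairs of
-- T₁ and T₂ with L(x) ≥ L(y), L(z) ≥ L(w).  Then (x,z) and one of (x,w), (y,z) are such vertices; they share
-- a coordinate, so slack 1 makes that coordinate have level 0, and then all three are such vertices,
-- which is one too many.  So d = 2.
module Submission where

open import Defs

module RadioLabelings where

  open import Data.Bool using (Bool; true; false; _∧_; _∨_; if_then_else_; _xor_; T; T?)
  open import Data.Nat
  open import Data.Nat.Properties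
  open import Data.Nat.Induction using (<-rec)
  open import Data.Nat.ListAction using (sum)
  open import Data.Nat.ListAction.Properties using (sum-↭)
  open import Data.Nat.Tactic.RingSolver using (solve-∀)
  open import Data.Fin
    using (Fin; zero; suc; inject₁; fromℕ; toℕ; opposite; combine; remQuot; quotient; remainder; _↑ˡ_; _↑ʳ_)
  import Data.Fin as Fin
  import Data.Fin.Properties as Fin
  open import Data.List using (List; []; _∷_; length; map; filterᵇ; tabulate; allFin)
  open import Data.List.Properties using (length-tabulate)
  import Data.List.Sort
  open import Data.List.Membership.Propositional using (_∈_)
  open import Data.List.Membership.Propositional.Properties using (∈-allFin)
  open import Data.List.Relation.Unary.All using ([]; _∷_)
  import Data.List.Relation.Unary.All.Properties as All
  open import Data.List.Relation.Unary.AllPairs as AllPairs using (AllPairs; []; _∷_)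
  open import Data.List.Relation.Unary.Any using (here; there)
  open import Data.List.Relation.Unary.Sorted.TotalOrder.Properties using (Sorted⇒AllPairs)
  import Data.List.Relation.Unary.Unique.Propositional.Properties as Unique
  open import Data.List.Relation.Binary.Permutation.Propositional using (_↭_; ↭-sym; ↭⇒↭ₛ)
  open import Data.List.Relation.Binary.Permutation.Propositional.Properties using (↭-length; ∈-resp-↭; map⁺)
  import Data.List.Relation.Binary.Permutation.Setoid.Properties as PermutationSetoid
  open import Data.Product using (∃; ∃₂; _×_; _,_; proj₁; proj₂)
  open import Data.Sum using (_⊎_; inj₁; inj₂)
  open import Data.Empty using (⊥; ⊥-elim)
  open import Function.Base using (_∘_; id)
  open import Function.Definitions using (Injective)
  open import Relation.Binary.Bundles using (DecTotalOrder)
  import Relation.Binary.Construct.On as On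
  open import Relation.Binary.Definitions using (tri<; tri≈; tri>)
  open import Relation.Nullary using (¬_; yes; no; contradiction)
  open import Relation.Binary.PropositionalEquality

  private
    variable
      m n k l : ℕ

  -- Booleans and bounded search.

  ∧-true : ∀ {a b} → a ∧ b ≡ true → a ≡ true × b ≡ true
  ∧-true {true} {true} _ = refl , refl

  ∨-true : ∀ {a b} → a ∨ b ≡ true → a ≡ true ⊎ b ≡ true
  ∨-true {true} _ = inj₁ refl
  ∨-true {false} e = inj₂ e

  ∨-trueˡ : ∀ {a b} → a ≡ true → a ∨ b ≡ true
  ∨-trueˡ refl = refl

  ∨-trueʳ : ∀ a {b} → b ≡ true → a ∨ b ≡ true
  ∨-trueʳ true _ = refl
  ∨-trueʳ false e = e

  ==-refl : (i : Fin n) → (i == i) ≡ true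
  ==-refl i with i Fin.≟ i
  ... | yes _ = refl
  ... | no i≢i = contradiction refl i≢i

  ==-sound : {i j : Fin n} → (i == j) ≡ true → i ≡ j
  ==-sound {i = i} {j} e with i Fin.≟ j
  ... | yes i≡j = i≡j

  anyF-sound : (p : Fin n → Bool) → anyF p ≡ true → ∃ λ i → p i ≡ true
  anyF-sound {suc n} p e with ∨-true {p zero} e
  ... | inj₁ p0 = zero , p0
  ... | inj₂ ps = let i , pi = anyF-sound (λ i → p (suc i)) ps in suc i , pi

  anyF-complete : (p : Fin n → Bool) (i : Fin n) → p i ≡ true → anyF p ≡ true
  anyF-complete p zero e rewrite e = refl
  anyF-complete p (suc i) e = ∨-trueʳ (p zero) (anyF-complete (λ j → p (suc j)) i e)

  search-≤ : ∀ (p : ℕ → Bool) fuel {k j} → k ≤ j → p j ≡ true → search p k fuel ≤ j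
  search-≤ p zero k≤j pj = k≤j
  search-≤ p (suc fuel) {k} {j} k≤j pj with p k in eq
  ... | true = k≤j
  ... | false = search-≤ p fuel (≤∧≢⇒< k≤j k≢j) pj
    where
    k≢j : k ≢ j
    k≢j refl with () ← trans (sym pj) eq

  -- When the fuel runs out, `search` returns its current index untested; `j ≤ k + fuel` forces that
  -- index to be `j`.
  search-sound : ∀ (p : ℕ → Bool) fuel {k j} → k ≤ j → j ≤ k + fuel → p j ≡ true → p (search p k fuel) ≡ true
  search-sound p zero {k} {j} k≤j j≤ pj
    rewrite ≤-antisym k≤j (subst (j ≤_) (+-identityʳ k) j≤) = pj
  search-sound p (suc fuel) {k} {j} k≤j j≤ pj with p k in eq
  ... | true = eq
  ... | false = search-sound p fuel (≤∧≢⇒< k≤j k≢j) (subst (j ≤_) (+-suc k fuel) j≤) pj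
    where
    k≢j : k ≢ j
    k≢j refl with () ← trans (sym pj) eq

  -- Walks and distances

  -- The index is the exact length, whereas `reach G k` accepts every length up to `k`.
  data Walk {n} (G : Graph n) : ℕ → Fin n → Fin n → Set where
    [] : ∀ {u} → Walk G 0 u u
    _∷_ : ∀ {k u w v} → G u w ≡ true → Walk G k w v → Walk G (suc k) u v

  module _ {G : Graph n} where

    infixr 5 _++_

    _++_ : ∀ {u v w} → Walk G k u v → Walk G l v w → Walk G (k + l) u w
    [] ++ q = q
    (e ∷ p) ++ q = e ∷ (p ++ q)

    reverse : IsSimple G → ∀ {u v} → Walk G k u v → Walk G k v u
    reverse sim [] = []
    reverse {suc k} sim {u} {v} (_∷_ {w = w} e p) =
      subst (λ i → Walk G i v u) (+-comm k 1)
        (reverse sim p ++ (trans (proj₁ sim w u) e ∷ []))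

    reach⇒walk : ∀ k {u v} → reach G k u v ≡ true → ∃ λ j → j ≤ k × Walk G j u v
    reach⇒walk zero e with refl ← ==-sound e = 0 , z≤n , []
    reach⇒walk (suc k) {u} {v} e with ∨-true {reach G k u v} e
    ... | inj₁ r = let j , j≤k , p = reach⇒walk k r in j , m≤n⇒m≤1+n j≤k , p
    ... | inj₂ a =
      let w , e = anyF-sound _ a
          uw , r = ∧-true {G u w} e
          j , j≤k , p = reach⇒walk k r
      in suc j , s≤s j≤k , uw ∷ p

    reach-refl : ∀ k u → reach G k u u ≡ true
    reach-refl zero u = ==-refl u
    reach-refl (suc k) u rewrite reach-refl k u = refl

    walk⇒reach : ∀ {j k u v} → j ≤ k → Walk G j u v → reach G k u v ≡ true
    walk⇒reach {k = k} j≤k [] = reach-refl k _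
    walk⇒reach {k = suc k} {u} {v} (s≤s j≤k) (_∷_ {w = w} e p) =
      ∨-trueʳ (reach G k u v) (anyF-complete _ w (cong₂ _∧_ e (walk⇒reach j≤k p)))

    vertex : ∀ {u v} → Walk G k u v → Fin (suc k) → Fin n
    vertex {u = u} p zero = u
    vertex (e ∷ p) (suc i) = vertex p i

    prefix : ∀ {u v} (p : Walk G k u v) i → Walk G (toℕ i) u (vertex p i)
    prefix p zero = []
    prefix (e ∷ p) (suc i) = e ∷ prefix p i

    suffix : ∀ {u v} (p : Walk G k u v) i → Walk G (k ∸ toℕ i) (vertex p i) v
    suffix p zero = p
    suffix (e ∷ p) (suc i) = suffix p i

    -- With `k ≥ n` edges there are more than `n` positions, so some vertex repeats, and the closed
    -- section between two visits is cut out.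
    shorten : ∀ {u v} → Walk G k u v → n ≤ k → ∃ λ j → j < k × Walk G j u v
    shorten {k = k} {u} {v} p n≤k with Fin.pigeonhole (s≤s n≤k) (vertex p)
    ... | i , j , i<j , eq =
      toℕ i + (k ∸ toℕ j) ,
      <-≤-trans (+-monoˡ-< (k ∸ toℕ j) i<j) (≤-reflexive (m+[n∸m]≡n (Fin.toℕ≤pred[n] j))) ,
      (prefix p i ++ subst (λ x → Walk G _ x v) (sym eq) (suffix p j))

    -- The bound `n` is the fuel given to `search` in `dist`, so the search gets as far as the
    -- length of such a walk.
    short-walk : ∀ k {u v} → Walk G k u v → ∃ λ j → j ≤ n × Walk G j u v
    short-walk = <-rec (λ k → ∀ {u v} → Walk G k u v → ∃ λ j → j ≤ n × Walk G j u v) step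
      where
      step : ∀ k → (∀ {j} → j < k → ∀ {u v} → Walk G j u v → ∃ λ j → j ≤ n × Walk G j u v) →
             ∀ {u v} → Walk G k u v → ∃ λ j → j ≤ n × Walk G j u v
      step k rec p with k ≤? n
      ... | yes k≤n = k , k≤n , p
      ... | no k≰n = let j , j<k , q = shorten p (≰⇒≥ k≰n) in rec j<k q

    dist-≤ : ∀ {u v} → Walk G k u v → dist G u v ≤ k
    dist-≤ p = search-≤ _ n z≤n (walk⇒reach ≤-refl p)

    -- `reach` yields a walk of length at most `dist G u v`, and `dist-≤` rules out a smaller
    -- length.
    shortest : IsConnected G → ∀ u v → Walk G (dist G u v) u v
    shortest conn u v =
      let k , r = conn u v
          _ , _ , p = reach⇒walk k r
          j , j≤n , q = short-walk _ p
          i , i≤d , w = reach⇒walk (dist G u v)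
            (search-sound (λ k → reach G k u v) n z≤n j≤n (walk⇒reach ≤-refl q))
      in subst (λ i → Walk G i u v) (≤-antisym i≤d (dist-≤ w)) w

    dist-refl : ∀ u → dist G u u ≡ 0
    dist-refl u = n≤0⇒n≡0 (dist-≤ [])

    module _ (sim : IsSimple G) (conn : IsConnected G) where

      dist-sym : ∀ u v → dist G u v ≡ dist G v u
      dist-sym u v = ≤-antisym (dist-≤ (reverse sim (shortest conn v u)))
                               (dist-≤ (reverse sim (shortest conn u v)))

      triangle : ∀ u v w → dist G u w ≤ dist G u v + dist G v w
      triangle u v w = dist-≤ (shortest conn u v ++ shortest conn v w)

      dist-0 : ∀ {u v} → dist G u v ≡ 0 → u ≡ v
      dist-0 {u} {v} e with dist G u v | shortest conn u v
      dist-0 refl | .0 | [] = refl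

      dist-1 : ∀ {u v} → dist G u v ≡ 1 → G u v ≡ true
      dist-1 {u} {v} e with dist G u v | shortest conn u v
      dist-1 refl | .1 | e ∷ [] = e

      first-step : ∀ {u v k} → dist G u v ≡ suc k → ∃ λ w → G u w ≡ true × dist G w v ≡ k
      first-step {u} {v} {k} d with dist G u v in eq | shortest conn u v
      first-step {u} {v} refl | _ | _∷_ {k = k} {w = w} e p =
        w , e , ≤-antisym (dist-≤ p) (≤-pred (subst (_≤ suc (dist G w v)) eq (dist-≤ (e ∷ shortest conn w v))))

  -- Extrema and the diameter.

  ≤-maxF : (f : Fin n → ℕ) (i : Fin n) → f i ≤ maxF f
  ≤-maxF f zero = m≤m⊔n _ _
  ≤-maxF f (suc i) = ≤-trans (≤-maxF (λ j → f (suc j)) i) (m≤n⊔m (f zero) _)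

  minF-≤ : (f : Fin n → ℕ) (i : Fin n) → minF f ≤ f i
  minF-≤ {suc zero} f zero = ≤-refl
  minF-≤ {suc (suc n)} f zero = m⊓n≤m _ _
  minF-≤ {suc (suc n)} f (suc i) = ≤-trans (m⊓n≤n (f zero) _) (minF-≤ (λ j → f (suc j)) i)

  maxF-attained : (f : Fin (suc n) → ℕ) → ∃ λ i → f i ≡ maxF f
  maxF-attained {zero} f = zero , sym (⊔-identityʳ _)
  maxF-attained {suc n} f with maxF-attained (λ i → f (suc i)) | ⊔-sel (f zero) (maxF (λ i → f (suc i)))
  ... | i , e | inj₁ s = zero , sym s
  ... | i , e | inj₂ s = suc i , trans e (sym s)

  dist-≤-diam : (G : Graph n) → ∀ u v → dist G u v ≤ diam G
  dist-≤-diam G u v = ≤-trans (≤-maxF (dist G u) v) (≤-maxF (λ u → maxF (dist G u)) u)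

  diam-attained : (G : Graph n) → Fin n → ∃₂ λ u v → dist G u v ≡ diam G
  diam-attained {suc n} G _ with maxF-attained (λ u → maxF (dist G u))
  ... | u , e with maxF-attained (dist G u)
  ...   | v , e′ = u , v , trans e′ e

  -- Acyclicity and weight centers

  sumF-mono-≤ : {f g : Fin n → ℕ} → (∀ i → f i ≤ g i) → sumF f ≤ sumF g
  sumF-mono-≤ {zero} f≤g = z≤n
  sumF-mono-≤ {suc n} f≤g = +-mono-≤ (f≤g zero) (sumF-mono-≤ (λ i → f≤g (suc i)))

  sumF-mono-< : {f g : Fin n → ℕ} → (∀ i → f i ≤ g i) → ∀ i → f i < g i → sumF f < sumF g
  sumF-mono-< f≤g zero f<g = +-mono-<-≤ f<g (sumF-mono-≤ (λ i → f≤g (suc i)))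
  sumF-mono-< f≤g (suc i) f<g = +-mono-≤-< (f≤g zero) (sumF-mono-< (λ i → f≤g (suc i)) i f<g)

  +-interchange : ∀ a b c d → (a + b) + (c + d) ≡ (a + c) + (b + d)
  +-interchange = solve-∀

  sumF-+ : (f g : Fin n → ℕ) → sumF (λ i → f i + g i) ≡ sumF f + sumF g
  sumF-+ {zero} f g = refl
  sumF-+ {suc n} f g
    rewrite sumF-+ (λ i → f (suc i)) (λ i → g (suc i)) = +-interchange (f zero) (g zero) _ _

  infixr 5 _◂_

  _◂_ : {A : Set} → A → (Fin k → A) → Fin (suc k) → A
  (x ◂ c) zero = x
  (x ◂ c) (suc i) = c i

  -- The fields match the path conditions in `Cycle`, so one closing edge turns a path on at least
  -- three vertices into a cycle.
  record IsPath {n k} (G : Graph n) (c : Fin (suc k) → Fin n) : Set where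
    constructor isPath
    field
      injective : Injective _≡_ _≡_ c
      adjacent : (i : Fin k) → G (c (inject₁ i)) (c (suc i)) ≡ true

  open IsPath

  opposite-inject₁ : (i : Fin n) → opposite (inject₁ i) ≡ suc (opposite i)
  opposite-inject₁ zero = refl
  opposite-inject₁ (suc i) = cong inject₁ (opposite-inject₁ i)

  opposite-fromℕ : ∀ k → opposite (fromℕ k) ≡ zero
  opposite-fromℕ zero = refl
  opposite-fromℕ (suc k) = cong inject₁ (opposite-fromℕ k)

  opposite-injective : Injective _≡_ _≡_ (opposite {n})
  opposite-injective {x = i} {j} e =
    trans (sym (Fin.opposite-involutive i)) (trans (cong opposite e) (Fin.opposite-involutive j))

  module _ {G : Graph n} where

    ◂-isPath : ∀ {x} {c : Fin (suc k) → Fin n} →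
      G x (c zero) ≡ true → (∀ i → x ≢ c i) → IsPath G c → IsPath G (x ◂ c)
    ◂-isPath {x = x} {c} e x∉c (isPath inj adj) = isPath inj′ adj′
      where
      inj′ : Injective _≡_ _≡_ (x ◂ c)
      inj′ {zero} {zero} _ = refl
      inj′ {zero} {suc j} e = contradiction e (x∉c j)
      inj′ {suc i} {zero} e = contradiction (sym e) (x∉c i)
      inj′ {suc i} {suc j} e = cong suc (inj e)
      adj′ : ∀ i → G ((x ◂ c) (inject₁ i)) (c i) ≡ true
      adj′ zero = e
      adj′ (suc i) = adj i

    reverse-isPath : IsSimple G → {c : Fin (suc k) → Fin n} → IsPath G c → IsPath G (c ∘ opposite)
    reverse-isPath (symm , _) {c} (isPath inj adj) = isPath (λ e → opposite-injective (inj e)) adj′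
      where
      adj′ : ∀ i → G (c (opposite (inject₁ i))) (c (inject₁ (opposite i))) ≡ true
      adj′ i rewrite opposite-inject₁ i = trans (symm _ _) (adj (opposite i))

  module Tree {T : Graph n} (tree : IsTree T) where

    sim = proj₁ tree
    conn = proj₁ (proj₂ tree)
    acyclic = proj₂ (proj₂ tree)

    -- Extending both ends of such a path towards u, the extensions must meet, closing a cycle.
    no-valley : ∀ {j} u D (c : Fin (2 + j) → Fin n) → IsPath T c →
      dist T (c zero) u ≡ D → dist T (c (fromℕ (suc j))) u ≡ D → (∀ i → D ≤ dist T (c i) u) → ⊥
    no-valley {j} u zero c (isPath inj _) d₀ d₁ _
      with () ← inj {zero} {fromℕ (suc j)} (trans (dist-0 sim conn d₀) (sym (dist-0 sim conn d₁)))
    no-valley {j} u (suc D) c path d₀ d₁ above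
      with first-step sim conn d₀ | first-step sim conn d₁
    ... | a , ca , a≡D | b , cb , b≡D with a Fin.≟ b
    ...   | yes refl = acyclic (j , a ◂ c , injective path₁ , adjacent path₁ , cb)
      where
      path₁ : IsPath T (a ◂ c)
      path₁ = ◂-isPath (trans (proj₁ sim _ _) ca)
        (λ i e → 1+n≰n (≤-trans (above i) (≤-reflexive (trans (cong (λ x → dist T x u) (sym e)) a≡D)))) path
    -- `_◂_` extends only the front, so the path is reversed before `b` is attached; its ends are
    -- now `b` and `a`, both at distance `D` from `u`.
    ...   | no a≢b = no-valley u D (b ◂ c₁ ∘ opposite) path₂ b≡D
                       (trans (cong (λ i → dist T (c₁ i) u) (opposite-fromℕ (2 + j))) a≡D)
                       λ { zero → ≤-reflexive (sym b≡D) ; (suc i) → above₁ (opposite i) }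
      where
      c₁ = a ◂ c
      below : ∀ {x} → dist T x u ≡ D → ∀ i → x ≢ c i
      below x≡D i e = 1+n≰n (≤-trans (above i) (≤-reflexive (trans (cong (λ x → dist T x u) (sym e)) x≡D)))
      path₁ : IsPath T c₁
      path₁ = ◂-isPath (trans (proj₁ sim _ _) ca) (below a≡D) path
      b∉c₁ : ∀ i → b ≢ c₁ i
      b∉c₁ zero e = a≢b (sym e)
      b∉c₁ (suc i) = below b≡D i
      path₂ : IsPath T (b ◂ c₁ ∘ opposite)
      path₂ = ◂-isPath (trans (proj₁ sim _ _) cb) (λ i → b∉c₁ (opposite i))
                       (reverse-isPath sim path₁)
      above₁ : ∀ i → D ≤ dist T (c₁ i) u
      above₁ zero = ≤-reflexive (sym a≡D)
      above₁ (suc i) = <⇒≤ (above i)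

    edge-≢ : ∀ {x y} → T x y ≡ true → x ≢ y
    edge-≢ e refl with () ← trans (sym e) (proj₂ sim _)

    singleton-isPath : ∀ x → IsPath T (λ (_ : Fin 1) → x)
    singleton-isPath x = isPath (λ { {zero} {zero} _ → refl }) λ ()

    edge-isPath : ∀ {x y} → T x y ≡ true → IsPath T (x ◂ λ (_ : Fin 1) → y)
    edge-isPath {y = y} e = ◂-isPath e (λ _ → edge-≢ e) (singleton-isPath y)

    step-≤ : ∀ {x y} u → T x y ≡ true → dist T x u ≤ suc (dist T y u)
    step-≤ u e = dist-≤ (e ∷ shortest conn _ u)

    -- Equal distances would make the edge itself a path forbidden by `no-valley`; adjacency limits
    -- the difference to 1.
    edge-dist : ∀ {x y} u → T x y ≡ true →
      dist T y u ≡ suc (dist T x u) ⊎ dist T x u ≡ suc (dist T y u)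
    edge-dist {x} {y} u e with <-cmp (dist T x u) (dist T y u)
    ... | tri< x<y _ _ = inj₁ (≤-antisym (step-≤ u (trans (proj₁ sim y x) e)) x<y)
    ... | tri> _ _ y<x = inj₂ (≤-antisym (step-≤ u e) y<x)
    ... | tri≈ _ x≡y _ = ⊥-elim (no-valley u (dist T x u) _ (edge-isPath e) refl (sym x≡y)
                                  λ { zero → ≤-refl ; (suc zero) → ≤-reflexive x≡y })

    -- This could fail only if `b` were farther from `u` than both neighbours, and then `a`, `b`,
    -- `c` would be a path forbidden by `no-valley`.
    dist-convex : ∀ {a b c} u → T b a ≡ true → T b c ≡ true → a ≢ c →
      dist T b u + dist T b u ≤ dist T a u + dist T c u
    dist-convex {a} {b} {c} u ba bc a≢c with edge-dist u ba | edge-dist u bc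
    ... | inj₁ a≡ | inj₁ c≡ rewrite a≡ | c≡ = +-mono-≤ (n≤1+n _) (n≤1+n _)
    ... | inj₁ a≡ | inj₂ b≡ rewrite a≡ | b≡ = ≤-reflexive (cong suc (+-suc _ _))
    ... | inj₂ b≡ | inj₁ c≡ rewrite c≡ | b≡ = ≤-reflexive (sym (+-suc _ _))
    ... | inj₂ b≡a | inj₂ b≡c = ⊥-elim
      (no-valley u (dist T a u) (a ◂ b ◂ λ (_ : Fin 1) → c) path refl (sym a≡c)
        λ { zero → ≤-refl
          ; (suc zero) → ≤-trans (n≤1+n _) (≤-reflexive (sym b≡a))
          ; (suc (suc zero)) → ≤-reflexive a≡c })
      where
      a≡c = suc-injective (trans (sym b≡a) b≡c)
      ab = trans (proj₁ sim a b) ba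
      path : IsPath T (a ◂ b ◂ λ _ → c)
      path = ◂-isPath ab (λ { zero → edge-≢ ab ; (suc zero) → a≢c }) (edge-isPath bc)

    -- `dist-convex` is summed over all `u`; the term at `u = b` makes the inequality strict, its
    -- left side being 0.
    weight-convex : ∀ {a b c} → T b a ≡ true → T b c ≡ true → a ≢ c →
      weight T b + weight T b < weight T a + weight T c
    weight-convex {a} {b} {c} ba bc a≢c =
      subst₂ _<_ (sumF-+ (λ u → dist T u b) _) (sumF-+ (λ u → dist T u a) _) (sumF-mono-< convex b strict)
      where
      convex : ∀ u → dist T u b + dist T u b ≤ dist T u a + dist T u c
      convex u rewrite dist-sym sim conn u a | dist-sym sim conn u b | dist-sym sim conn u c =
        dist-convex u ba bc a≢c
      strict : dist T b b + dist T b b < dist T b a + dist T b c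
      strict with dist T b a in eq
      ... | zero = ⊥-elim (edge-≢ ba (dist-0 sim conn eq))
      ... | suc _ rewrite dist-refl {G = T} b = z<s

    -- Strict convexity turns `weight T a ≤ weight T b` into a strict rise at the next step towards
    -- `v`, and the rise propagates by induction. The distances to `v` ensure that this step does
    -- not turn back to `a`.
    weight-rises : ∀ k {a b v} → T b a ≡ true → weight T a ≤ weight T b →
      dist T b v ≡ suc k → dist T a v ≡ suc (suc k) → weight T b < weight T v
    weight-rises k {a} {b} {v} ba wa≤wb bv av with first-step sim conn bv
    ... | c , bc , cv = rises k cv bv
      where
      a≢c : a ≢ c
      a≢c refl = m≢1+n+m k (trans (sym cv) av)
      wb<wc : weight T b < weight T c
      wb<wc = +-cancelˡ-< (weight T b) _ _
        (<-≤-trans (weight-convex ba bc a≢c) (+-monoˡ-≤ (weight T c) wa≤wb))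
      rises : ∀ k → dist T c v ≡ k → dist T b v ≡ suc k → weight T b < weight T v
      rises zero cv bv = subst (λ x → weight T b < weight T x) (dist-0 sim conn cv) wb<wc
      rises (suc k) cv bv =
        <-trans wb<wc (weight-rises k (trans (proj₁ sim c b) bc) (<⇒≤ wb<wc) cv bv)

    -- At distance 2 or more, the first step from `w` towards `v` cannot lower the weight, so by
    -- `weight-rises` `v` would be heavier than that neighbour of `w`.
    centers-adjacent : ∀ {w v} → (∀ u → weight T w ≤ weight T u) → (∀ u → weight T v ≤ weight T u) →
      dist T w v ≤ 1
    centers-adjacent {w} {v} w-min v-min with dist T w v in eq
    ... | zero = z≤n
    ... | suc zero = ≤-refl
    ... | suc (suc k) with first-step sim conn eq
    ...   | b , wb , bv = ⊥-elim (<⇒≱ (weight-rises k (trans (proj₁ sim b w) wb) (w-min b) bv eq) (v-min b))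

  -- The two sides of a tree with two weight centers.

  length-filterᵇ-tabulate : {A : Set} (p : A → Bool) (g : Fin n → A) →
    length (filterᵇ p (tabulate g)) ≡ sumF (λ i → if p (g i) then 1 else 0)
  length-filterᵇ-tabulate {zero} p g = refl
  length-filterᵇ-tabulate {suc n} p g with p (g zero)
  ... | true = cong suc (length-filterᵇ-tabulate p (λ i → g (suc i)))
  ... | false = length-filterᵇ-tabulate p (λ i → g (suc i))

  center-minimal : (G : Graph n) {v : Fin n} → T (isWeightCenter G v) → ∀ u → weight G v ≤ weight G u
  center-minimal G c u = ≤-trans (≤-reflexive (≡ᵇ⇒≡ _ _ c)) (minF-≤ (weight G) u)

  -- Matching the list of centers as `w ∷ v ∷ []` lets every level compute; `minL` starts its fold
  -- from the head, so the distance to `w` comes second.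
  two-centers : (G : Graph n) → numWeightCenters G ≡ 2 →
    ∃₂ λ w v → w ≢ v × (∀ u → weight G w ≤ weight G u) × (∀ u → weight G v ≤ weight G u)
      × (∀ u → level G u ≡ dist G u v ⊓ dist G u w)
  two-centers {n} G two
    with weightCenters G
       | trans (length-filterᵇ-tabulate (isWeightCenter G) (λ i → i)) two
       | All.all-filter (λ v → T? (isWeightCenter G v)) (tabulate (λ i → i))
       | Unique.filter⁺ (λ v → T? (isWeightCenter G v)) (Unique.allFin⁺ n)
  ... | w ∷ v ∷ [] | refl | cw ∷ cv ∷ [] | (w≢v ∷ []) ∷ _ =
    w , v , w≢v , center-minimal G cw , center-minimal G cv , λ _ → refl

  -- Models a tree cut at the edge between its two weight centers: the `+ 1` pays for crossing that
  -- edge, and the poles witness that neither side is empty.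
  record Bipolar (G : Graph n) : Set where
    field
      side : Fin n → Bool
      dist-≤-levels : ∀ u v → dist G u v ≤ level G u + level G v + 1
      same-side : ∀ u v → side u ≡ side v → dist G u v ≤ level G u + level G v
      pole₁ pole₂ : Fin n
      opposite-poles : side pole₁ ≢ side pole₂

  bipolar : {G : Graph n} → IsTree G → numWeightCenters G ≡ 2 → Bipolar G
  bipolar {n} {G} tree two with two-centers G two
  ... | w , v , w≢v , w-min , v-min , level≡ = record
    { side = side ; dist-≤-levels = far ; same-side = near
    ; pole₁ = w ; pole₂ = v ; opposite-poles = poles }
    where
    open Tree tree
    d = dist G

    side : Fin n → Bool
    side u = d u w ≤ᵇ d u v

    pole : Bool → Fin n
    pole true = w
    pole false = v

    level-side : ∀ u → level G u ≡ d u (pole (side u))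
    level-side u rewrite level≡ u with d u w ≤ᵇ d u v in eq
    ... | true = m≥n⇒m⊓n≡n (≤ᵇ⇒≤ _ _ (subst T (sym eq) _))
    ... | false = m≤n⇒m⊓n≡m (≰⇒≥ λ le → subst T eq (≤⇒≤ᵇ le))

    near : ∀ x y → side x ≡ side y → d x y ≤ level G x + level G y
    near x y e rewrite level-side x | level-side y | e =
      ≤-trans (triangle sim conn x _ y) (+-monoʳ-≤ _ (≤-reflexive (dist-sym sim conn _ y)))

    pole-dist : ∀ a b → d (pole a) (pole b) ≤ 1
    pole-dist true true = ≤-trans (≤-reflexive (dist-refl {G = G} w)) z≤n
    pole-dist true false = centers-adjacent w-min v-min
    pole-dist false true = centers-adjacent v-min w-min
    pole-dist false false = ≤-trans (≤-reflexive (dist-refl {G = G} v)) z≤n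

    rearrange : ∀ a b c → a + (b + c) ≡ a + c + b
    rearrange = solve-∀

    -- The route goes through the center on each endpoint's side; the two centers are at most 1
    -- apart.
    far : ∀ x y → d x y ≤ level G x + level G y + 1
    far x y = begin
      d x y                                     ≤⟨ triangle sim conn x px y ⟩
      d x px + d px y                           ≤⟨ +-monoʳ-≤ _ (triangle sim conn px py y) ⟩
      d x px + (d px py + d py y)               ≤⟨ +-monoʳ-≤ (d x px) (+-monoˡ-≤ _ (pole-dist _ _)) ⟩
      d x px + (1 + d py y)                     ≡⟨ rearrange (d x px) 1 (d py y) ⟩
      d x px + d py y + 1                       ≡⟨ cong₂ (λ a b → a + b + 1) (level-side x)
                                                    (trans (level-side y) (dist-sym sim conn y py)) ⟨
      level G x + level G y + 1                 ∎
      where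
      open ≤-Reasoning
      px = pole (side x)
      py = pole (side y)

    poles : side w ≢ side v
    poles e with d v w in eq
    ... | zero = w≢v (sym (dist-0 sim conn eq))
    ... | suc _ rewrite dist-refl {G = G} w | dist-refl {G = G} v with () ← e

  -- Cartesian products

  module Product {m n : ℕ} (G : Graph m) (H : Graph n) where

    π₁ : Fin (m * n) → Fin m
    π₁ = quotient {m} n

    π₂ : Fin (m * n) → Fin n
    π₂ = remainder {m} n

    π₁-combine : ∀ (a : Fin m) (b : Fin n) → π₁ (combine a b) ≡ a
    π₁-combine a b = cong proj₁ (Fin.remQuot-combine a b)

    π₂-combine : ∀ (a : Fin m) (b : Fin n) → π₂ (combine a b) ≡ b
    π₂-combine a b = cong proj₂ (Fin.remQuot-combine a b)

    combine-π : ∀ x → combine (π₁ x) (π₂ x) ≡ x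
    combine-π = Fin.combine-remQuot {m} n

    □-edge : ∀ x y → (G □ H) x y ≡
      ((π₁ x == π₁ y) ∧ H (π₂ x) (π₂ y)) ∨ (G (π₁ x) (π₁ y) ∧ (π₂ x == π₂ y))
    □-edge x y with remQuot {m} n x | remQuot {m} n y
    ... | _ , _ | _ , _ = refl

    □-edge₁ : ∀ {a a′} (b : Fin n) → G a a′ ≡ true → (G □ H) (combine a b) (combine a′ b) ≡ true
    □-edge₁ {a} {a′} b e = trans (□-edge (combine a b) (combine a′ b)) (∨-trueʳ _ (cong₂ _∧_
      (trans (cong₂ G (π₁-combine a b) (π₁-combine a′ b)) e)
      (trans (cong₂ _==_ (π₂-combine a b) (π₂-combine a′ b)) (==-refl b))))

    □-edge₂ : ∀ (a : Fin m) {b b′} → H b b′ ≡ true → (G □ H) (combine a b) (combine a b′) ≡ true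
    □-edge₂ a {b} {b′} e = trans (□-edge (combine a b) (combine a b′)) (∨-trueˡ (cong₂ _∧_
      (trans (cong₂ _==_ (π₁-combine a b) (π₁-combine a b′)) (==-refl a))
      (trans (cong₂ H (π₂-combine a b) (π₂-combine a b′)) e)))

    □-walk₁ : ∀ {a a′} (b : Fin n) → Walk G k a a′ → Walk (G □ H) k (combine a b) (combine a′ b)
    □-walk₁ b [] = []
    □-walk₁ b (e ∷ p) = □-edge₁ b e ∷ □-walk₁ b p

    □-walk₂ : ∀ (a : Fin m) {b b′} → Walk H k b b′ → Walk (G □ H) k (combine a b) (combine a b′)
    □-walk₂ a [] = []
    □-walk₂ a (e ∷ p) = □-edge₂ a e ∷ □-walk₂ a p

    -- Each edge of the product is an edge in one coordinate and fixes the other, so the lengths of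
    -- the projected walks add up. This bounds product distances from below.
    □-project : ∀ {x y} → Walk (G □ H) k x y →
      ∃₂ λ i j → i + j ≡ k × Walk G i (π₁ x) (π₁ y) × Walk H j (π₂ x) (π₂ y)
    □-project [] = 0 , 0 , refl , [] , []
    □-project {x = x} {y} (_∷_ {w = w} e p)
      with □-project p | ∨-true {(π₁ x == π₁ w) ∧ H (π₂ x) (π₂ w)} (trans (sym (□-edge x w)) e)
    ... | i , j , eq , g , h | inj₁ e′ =
      let a , b = ∧-true {π₁ x == π₁ w} e′
      in i , suc j , trans (+-suc i j) (cong suc eq) ,
         subst (λ u → Walk G i u (π₁ y)) (sym (==-sound a)) g , b ∷ h
    ... | i , j , eq , g , h | inj₂ e′ =
      let a , b = ∧-true {G (π₁ x) (π₁ w)} e′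
      in suc i , j , cong suc eq ,
         a ∷ g , subst (λ u → Walk H j u (π₂ y)) (sym (==-sound b)) h

    module _ (connG : IsConnected G) (connH : IsConnected H) where

      □-walk : ∀ x y → Walk (G □ H) (dist G (π₁ x) (π₁ y) + dist H (π₂ x) (π₂ y)) x y
      □-walk x y = subst₂ (Walk (G □ H) _) (combine-π x) (combine-π y)
        (□-walk₁ (π₂ x) (shortest connG (π₁ x) (π₁ y)) ++
         □-walk₂ (π₁ y) (shortest connH (π₂ x) (π₂ y)))

      □-connected : IsConnected (G □ H)
      □-connected x y = dist G (π₁ x) (π₁ y) + dist H (π₂ x) (π₂ y) , walk⇒reach ≤-refl (□-walk x y)

      dist-□-≤ : ∀ x y → dist (G □ H) x y ≤ dist G (π₁ x) (π₁ y) + dist H (π₂ x) (π₂ y)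
      dist-□-≤ x y = dist-≤ (□-walk x y)

      dist-□-≥ : ∀ x y → dist G (π₁ x) (π₁ y) + dist H (π₂ x) (π₂ y) ≤ dist (G □ H) x y
      dist-□-≥ x y =
        let i , j , eq , g , h = □-project (shortest □-connected x y)
        in ≤-trans (+-mono-≤ (dist-≤ g) (dist-≤ h)) (≤-reflexive eq)

      dist-+-≤-diam-□ : ∀ a a′ b b′ → dist G a a′ + dist H b b′ ≤ diam (G □ H)
      dist-+-≤-diam-□ a a′ b b′ = ≤-trans (≤-reflexive (sym projections))
        (≤-trans (dist-□-≥ x y) (dist-≤-diam (G □ H) x y))
        where
        x = combine a b
        y = combine a′ b′
        projections : dist G (π₁ x) (π₁ y) + dist H (π₂ x) (π₂ y) ≡ dist G a a′ + dist H b b′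
        projections = cong₂ _+_ (cong₂ (dist G) (π₁-combine a b) (π₁-combine a′ b′))
                                (cong₂ (dist H) (π₂-combine a b) (π₂-combine a′ b′))

  -- Sums over the vertices of a product.

  sumF-cong : {f g : Fin n → ℕ} → (∀ i → f i ≡ g i) → sumF f ≡ sumF g
  sumF-cong {zero} e = refl
  sumF-cong {suc n} e = cong₂ _+_ (e zero) (sumF-cong (λ i → e (suc i)))

  sumF-const : ∀ n c → sumF {n} (λ _ → c) ≡ n * c
  sumF-const zero c = refl
  sumF-const (suc n) c = cong (c +_) (sumF-const n c)

  sumF-*ˡ : ∀ c (f : Fin n → ℕ) → sumF (λ i → c * f i) ≡ c * sumF f
  sumF-*ˡ {zero} c f = sym (*-zeroʳ c)
  sumF-*ˡ {suc n} c f =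
    trans (cong (c * f zero +_) (sumF-*ˡ c (λ i → f (suc i)))) (sym (*-distribˡ-+ c (f zero) _))

  sumF-↑ : ∀ m (f : Fin (m + n) → ℕ) → sumF f ≡ sumF (λ i → f (i ↑ˡ n)) + sumF (λ j → f (m ↑ʳ j))
  sumF-↑ zero f = refl
  sumF-↑ (suc m) f = trans (cong (f zero +_) (sumF-↑ m (λ i → f (suc i)))) (sym (+-assoc (f zero) _ _))

  sumF-combine : ∀ m (f : Fin (m * n) → ℕ) → sumF f ≡ sumF {m} (λ a → sumF {n} (λ b → f (combine a b)))
  sumF-combine zero f = refl
  sumF-combine {n} (suc m) f =
    trans (sumF-↑ n f) (cong (sumF (λ b → f (b ↑ˡ (m * n))) +_) (sumF-combine m (λ j → f (n ↑ʳ j))))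

  sumF-separate : ∀ m n (g : Fin m → ℕ) (h : Fin n → ℕ) →
    sumF {m} (λ a → sumF {n} (λ b → g a + h b)) ≡ n * sumF g + m * sumF h
  sumF-separate m n g h = begin
    sumF {m} (λ a → sumF {n} (λ b → g a + h b))  ≡⟨ sumF-cong (λ a → trans (sumF-+ (λ _ → g a) h)
                                                                  (cong (_+ sumF h) (sumF-const n (g a)))) ⟩
    sumF {m} (λ a → n * g a + sumF h)            ≡⟨ sumF-+ (λ a → n * g a) (λ _ → sumF h) ⟩
    sumF {m} (λ a → n * g a) + sumF {m} (λ _ → sumF h)
                                                 ≡⟨ cong₂ _+_ (sumF-*ˡ n g) (sumF-const m (sumF h)) ⟩
    n * sumF g + m * sumF h                      ∎
    where open ≡-Reasoning

  -- Labelings sorted by value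

  ≢-trans-≡ : ∀ {a b c : Bool} → a ≢ b → b ≢ c → a ≡ c
  ≢-trans-≡ {true} {b} {true} _ _ = refl
  ≢-trans-≡ {false} {b} {false} _ _ = refl
  ≢-trans-≡ {true} {true} {false} p _ = contradiction refl p
  ≢-trans-≡ {true} {false} {false} _ q = contradiction refl q
  ≢-trans-≡ {false} {true} {true} _ q = contradiction refl q
  ≢-trans-≡ {false} {false} {true} p _ = contradiction refl p

  -- Applied to tight steps: switching both sides keeps `diagonal`.
  xor-≢ : ∀ {a a′ b b′ : Bool} → a ≢ a′ → b ≢ b′ → a xor b ≡ a′ xor b′
  xor-≢ {true} {true} p _ = contradiction refl p
  xor-≢ {false} {false} p _ = contradiction refl p
  xor-≢ {true} {false} {true} {true} _ q = contradiction refl q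
  xor-≢ {true} {false} {false} {false} _ q = contradiction refl q
  xor-≢ {true} {false} {true} {false} _ _ = refl
  xor-≢ {true} {false} {false} {true} _ _ = refl
  xor-≢ {false} {true} {true} {true} _ q = contradiction refl q
  xor-≢ {false} {true} {false} {false} _ q = contradiction refl q
  xor-≢ {false} {true} {true} {false} _ _ = refl
  xor-≢ {false} {true} {false} {true} _ _ = refl

  xor-cancelʳ : ∀ a b c → a xor c ≡ b xor c → a ≡ b
  xor-cancelʳ true true _ _ = refl
  xor-cancelʳ false false _ _ = refl
  xor-cancelʳ true false true ()
  xor-cancelʳ true false false ()
  xor-cancelʳ false true true ()
  xor-cancelʳ false true false ()

  last : {A : Set} → A → List A → A
  last x [] = x
  last x (y ∷ ys) = last y ys

  -- Serves to add up known inequalities: `c` collects the common terms, and the two regroupings are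
  -- left to the ring solver.
  cancel-≤ : ∀ c {a b x y} → x ≤ y → c + a ≡ x → y ≡ c + b → a ≤ b
  cancel-≤ c {a} {b} x≤y e e′ = +-cancelˡ-≤ c a b (subst₂ _≤_ (sym e) e′ x≤y)

  -- The radio condition is stated additively with the smaller label first, which avoids truncated
  -- subtraction. The bounds on `D` lose 1 for each coordinate in which the vertices share a side.
  module Labeling {V : Set} (f L : V → ℕ) (D : V → V → ℕ) (d : ℕ) (side₁ side₂ : V → Bool)
    (separated : ∀ u v → f u < f v → d + 1 + f u ≤ f v + D u v)
    (D-≤ : ∀ u v → D u v ≤ L u + L v + 2)
    (D-≤₁ : ∀ u v → side₁ u ≡ side₁ v → D u v ≤ L u + L v + 1)
    (D-≤₂ : ∀ u v → side₂ u ≡ side₂ v → D u v ≤ L u + L v + 1)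
    (D-≤₁₂ : ∀ u v → side₁ u ≡ side₁ v → side₂ u ≡ side₂ v → D u v ≤ L u + L v)
    where

    _≺_ : V → V → Set
    u ≺ v = f u < f v

    -- For `u ≺ v` the subtraction is not truncated: `separated` and `D-≤` give
    -- `f u + d ≤ f v + L u + L v + 1`.
    slack : V → V → ℕ
    slack u v = f v + L u + L v + 1 ∸ (f u + d)

    High : V → Set
    High v = d ≤ L v + L v + 2

    slack-≡ : ∀ {u v} → u ≺ v → f u + d + slack u v ≡ f v + L u + L v + 1
    slack-≡ {u} {v} u≺v = m+[n∸m]≡n
      (cancel-≤ 1 (≤-trans (separated u v u≺v) (+-monoʳ-≤ (f v) (D-≤ u v)))
        (eq₁ (f u) d) (eq₂ (f v) (L u) (L v)))
      where
      eq₁ : ∀ a d → 1 + (a + d) ≡ d + 1 + a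
      eq₁ = solve-∀
      eq₂ : ∀ a b c → a + (b + c + 2) ≡ 1 + (a + b + c + 1)
      eq₂ = solve-∀

    slack-≤⇒ : ∀ {u v s} → u ≺ v → slack u v ≤ s → f v + L u + L v + 1 ≤ f u + d + s
    slack-≤⇒ {u} {v} {s} u≺v le = subst (_≤ f u + d + s) (slack-≡ u≺v) (+-monoʳ-≤ (f u + d) le)

    -- Adding the slack bound to `separated` cancels both labels and `d`: little slack forces
    -- `D u v` close to its upper bound `L u + L v + 2`.
    slack-≤⇒D : ∀ {u v s} → u ≺ v → slack u v ≤ s → L u + L v + 2 ≤ D u v + s
    slack-≤⇒D {u} {v} {s} u≺v le =
      cancel-≤ (f v + d + f u) (+-mono-≤ (slack-≤⇒ u≺v le) (separated u v u≺v))
        (eq₁ (f u) (f v) (L u) (L v) d) (eq₂ (f u) (f v) (D u v) d s)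
      where
      eq₁ : ∀ a b p q d → b + d + a + (p + q + 2) ≡ b + p + q + 1 + (d + 1 + a)
      eq₁ = solve-∀
      eq₂ : ∀ a b p d s → a + d + s + (b + p) ≡ b + d + a + (p + s)
      eq₂ = solve-∀

    -- Slack 0 forces `D u v ≥ L u + L v + 2`, one more than a common side allows.
    tight-opposite₁ : ∀ {u v} → u ≺ v → slack u v ≡ 0 → side₁ u ≢ side₁ v
    tight-opposite₁ {u} {v} u≺v s≡0 e = m+1+n≰m (L u + L v + 1)
      (≤-trans (≤-reflexive (+-assoc (L u + L v) 1 1))
      (≤-trans (slack-≤⇒D u≺v (≤-reflexive s≡0))
      (≤-trans (≤-reflexive (+-identityʳ _)) (D-≤₁ u v e))))

    tight-opposite₂ : ∀ {u v} → u ≺ v → slack u v ≡ 0 → side₂ u ≢ side₂ v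
    tight-opposite₂ {u} {v} u≺v s≡0 e = m+1+n≰m (L u + L v + 1)
      (≤-trans (≤-reflexive (+-assoc (L u + L v) 1 1))
      (≤-trans (slack-≤⇒D u≺v (≤-reflexive s≡0))
      (≤-trans (≤-reflexive (+-identityʳ _)) (D-≤₂ u v e))))

    -- u and w lie on the same sides, which bounds D u w, while f w - f u is exactly the sum of two tight steps.
    tight-tight-¬High : ∀ {u v w} → u ≺ v → v ≺ w → slack u v ≡ 0 → slack v w ≡ 0 → ¬ High v
    tight-tight-¬High {u} {v} {w} u≺v v≺w suv svw =
      <⇒≱ (cancel-≤ (f v + f w + f u + L u + L w + d)
        (+-mono-≤ (+-mono-≤ (slack-≤⇒ u≺v (≤-reflexive suv)) (slack-≤⇒ v≺w (≤-reflexive svw)))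
                  (≤-trans (separated u w (<-trans u≺v v≺w)) (+-monoʳ-≤ (f w) same-sides)))
        (eq₁ (f u) (f v) (f w) (L u) (L v) (L w) d) (eq₂ (f u) (f v) (f w) (L u) (L w) d))
      where
      same-sides : D u w ≤ L u + L w
      same-sides = D-≤₁₂ u w
        (≢-trans-≡ (tight-opposite₁ u≺v suv) (tight-opposite₁ v≺w svw))
        (≢-trans-≡ (tight-opposite₂ u≺v suv) (tight-opposite₂ v≺w svw))
      eq₁ : ∀ a b c p q r d → b + c + a + p + r + d + suc (q + q + 2) ≡
        b + p + q + 1 + (c + q + r + 1) + (d + 1 + a)
      eq₁ = solve-∀
      eq₂ : ∀ a b c p r d → a + d + 0 + (b + d + 0) + (c + (p + r)) ≡ b + c + a + p + r + d + d
      eq₂ = solve-∀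

    slacks : V → List V → ℕ
    slacks x [] = 0
    slacks x (y ∷ ys) = slack x y + slacks y ys

    -- Summing `slack-≡` over the steps cancels the intermediate labels. Interior levels occur in
    -- two steps and the end levels in one, so adding the end levels once more gives twice the total
    -- level.
    telescope : ∀ x ys → AllPairs _≺_ (x ∷ ys) →
      f x + L x + L (last x ys) + length ys * d + slacks x ys ≤
      f (last x ys) + (sum (map L (x ∷ ys)) + sum (map L (x ∷ ys))) + length ys
    telescope x [] _ = ≤-reflexive (eq (f x) (L x))
      where
      eq : ∀ a p → a + p + p + 0 + 0 ≡ a + (p + 0 + (p + 0)) + 0
      eq = solve-∀
    telescope x (y ∷ ys) ((x≺y ∷ _) ∷ ordered) =
      cancel-≤ (f y + L y) (+-monoˡ-≤ (L x) (+-mono-≤ (telescope y ys ordered) (≤-reflexive (slack-≡ x≺y))))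
        (eq₁ (f x) (L x) (f y) (L y) (L (last y ys)) (length ys) d (slacks y ys) (slack x y))
        (eq₂ (f y) (L x) (L y) (f (last y ys)) (sum (map L ys)) (length ys))
      where
      eq₁ : ∀ a p b q r n d s t → b + q + (a + p + r + (d + n * d) + (t + s)) ≡
        b + q + r + n * d + s + (a + d + t) + p
      eq₁ = solve-∀
      eq₂ : ∀ b p q c s n → c + (q + s + (q + s)) + n + (b + p + q + 1) + p ≡
        b + q + (c + (p + (q + s) + (p + (q + s))) + (1 + n))
      eq₂ = solve-∀

    -- False on {LL, RR}, true on {LR, RL}.
    diagonal : V → Bool
    diagonal v = side₁ v xor side₂ v

    tight⇒diagonal : ∀ x ys → AllPairs _≺_ (x ∷ ys) → slacks x ys ≡ 0 →
      ∀ {v} → v ∈ x ∷ ys → diagonal x ≡ diagonal v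
    tight⇒diagonal x ys _ _ (here refl) = refl
    tight⇒diagonal x (y ∷ ys) ((x≺y ∷ _) ∷ ordered) s (there v∈) =
      trans (xor-≢ (tight-opposite₁ x≺y sxy) (tight-opposite₂ x≺y sxy))
            (tight⇒diagonal y ys ordered (m+n≡0⇒n≡0 (slack x y) s) v∈)
      where
      sxy = m+n≡0⇒m≡0 (slack x y) s

    -- Invariant for a traversal of the list: `tight-tight-¬High` supplies it after a tight step,
    -- and at the first vertex it comes from level 0.
    Low-before-tight : V → Set
    Low-before-tight x = ∀ {z} → x ≺ z → slack x z ≡ 0 → ¬ High x

    -- Every vertex but the last is followed by a tight step, so the invariant excludes it.
    tight⇒High-last : ∀ x ys → AllPairs _≺_ (x ∷ ys) → slacks x ys ≡ 0 → Low-before-tight x →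
      ∀ {v} → v ∈ x ∷ ys → High v → v ≡ last x ys
    tight⇒High-last x [] _ _ _ (here refl) _ = refl
    tight⇒High-last x (y ∷ ys) ((x≺y ∷ _) ∷ _) s low (here refl) high =
      contradiction high (low x≺y (m+n≡0⇒m≡0 (slack x y) s))
    tight⇒High-last x (y ∷ ys) ((x≺y ∷ _) ∷ ordered) s low (there v∈) =
      tight⇒High-last y ys ordered (m+n≡0⇒n≡0 (slack x y) s)
        (λ y≺z → tight-tight-¬High x≺y y≺z (m+n≡0⇒m≡0 (slack x y) s)) v∈

    -- The step of slack 1 interrupts the invariant only at its own two ends; all other vertices
    -- before the last are followed by a tight step and excluded.
    loose-step : ∀ x ys → AllPairs _≺_ (x ∷ ys) → slacks x ys ≡ 1 → Low-before-tight x →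
      ∃₂ λ a b → a ≺ b × slack a b ≡ 1 ×
        (∀ {v} → v ∈ x ∷ ys → High v → v ≡ a ⊎ v ≡ b ⊎ v ≡ last x ys)
    loose-step x (y ∷ ys) ((x≺y ∷ _) ∷ ordered) s low with slack x y in sxy
    ... | zero = let a , b , a≺b , sab , high = loose-step y ys ordered s low-y in
      a , b , a≺b , sab , λ { (here refl) h → contradiction h (low x≺y sxy) ; (there v∈) → high v∈ }
      where
      low-y : Low-before-tight y
      low-y y≺z = tight-tight-¬High x≺y y≺z sxy
    ... | suc zero = x , y , x≺y , sxy , λ { (here refl) _ → inj₁ refl ; (there v∈) h → inj₂ (high ordered v∈ h) }
      where
      -- All steps after `y` are tight, but `y` itself follows the loose step, so the invariant
      -- restarts only at `z`.
      high : AllPairs _≺_ (y ∷ ys) → ∀ {v} → v ∈ y ∷ ys → High v → v ≡ y ⊎ v ≡ last y ys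
      high _ (here refl) _ = inj₁ refl
      high ((y≺z ∷ _) ∷ ordered′) (there {xs = z ∷ zs} v∈) h =
        inj₂ (tight⇒High-last z zs ordered′ (m+n≡0⇒n≡0 (slack y z) (suc-injective s))
          (λ z≺w → tight-tight-¬High y≺z z≺w (m+n≡0⇒m≡0 (slack y z) (suc-injective s))) v∈ h)

    -- Tight steps preserve the diagonal, so some step has positive slack, and the bound leaves room for one only.
    critical-pair : ∀ x ys → AllPairs _≺_ (x ∷ ys) → (∀ v → v ∈ x ∷ ys) →
      L x + L (last x ys) + slacks x ys ≤ 1 → (∃₂ λ u v → diagonal u ≢ diagonal v) → 3 ≤ d →
      ∃₂ λ a b → L a + L b + 1 ≤ D a b × (∀ v → High v → v ≡ a ⊎ v ≡ b)
    critical-pair x ys ordered complete small (u , v , u≢v) 3≤d with slacks x ys in s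
    ... | zero = contradiction
      (trans (sym (tight⇒diagonal x ys ordered s (complete u))) (tight⇒diagonal x ys ordered s (complete v))) u≢v
    ... | suc t = a , b , cancel-≤ 1 (slack-≤⇒D a≺b (≤-reflexive sab)) (eq (L a) (L b)) (+-comm (D a b) 1) , only
      where
      ends : L x + L (last x ys) + t ≡ 0
      ends = n≤0⇒n≡0 (≤-pred (≤-trans (≤-reflexive (sym (+-suc _ t))) small))
      Lx≡0 = m+n≡0⇒m≡0 (L x) (m+n≡0⇒m≡0 (L x + L (last x ys)) ends)
      Ll≡0 = m+n≡0⇒n≡0 (L x) (m+n≡0⇒m≡0 (L x + L (last x ys)) ends)
      -- A high vertex of level 0 would give `d ≤ 2`. This starts the invariant at `x` and removes
      -- the last vertex from the candidates.
      not-High : ∀ {z} → L z ≡ 0 → ¬ High z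
      not-High {z} e h = <⇒≱ 3≤d (subst (λ l → d ≤ l + l + 2) e h)
      step = loose-step x ys ordered (trans s (cong suc (m+n≡0⇒n≡0 (L x + L (last x ys)) ends)))
               (λ _ _ → not-High Lx≡0)
      a = proj₁ step
      b = proj₁ (proj₂ step)
      a≺b = proj₁ (proj₂ (proj₂ step))
      sab = proj₁ (proj₂ (proj₂ (proj₂ step)))
      only : ∀ v → High v → v ≡ a ⊎ v ≡ b
      only v h with proj₂ (proj₂ (proj₂ (proj₂ step))) (complete v) h
      ... | inj₁ e = inj₁ e
      ... | inj₂ (inj₁ e) = inj₂ e
      ... | inj₂ (inj₂ refl) = contradiction h (not-High Ll≡0)
      eq : ∀ p q → 1 + (p + q + 1) ≡ p + q + 2
      eq = solve-∀

  -- Products of trees with two weight centers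

  sum-tabulate : {A : Set} (g : A → ℕ) (h : Fin n → A) → sum (map g (tabulate h)) ≡ sumF (g ∘ h)
  sum-tabulate {zero} g h = refl
  sum-tabulate {suc n} g h = cong (g (h zero) +_) (sum-tabulate g (h ∘ suc))

  -- Sorting by `f` gives weakly increasing labels; distinct entries and injectivity make them
  -- strictly increasing.
  sorted-enumeration : (f : Fin n → ℕ) → Injective _≡_ _≡_ f →
    ∃ λ xs → xs ↭ allFin n × AllPairs (λ u v → f u < f v) xs
  sorted-enumeration {n} f inj =
    sort (allFin n) , perm , AllPairs.zipWith (λ (le , ne) → ≤∧≢⇒< le (ne ∘ inj)) (weakly , unique)
    where
    order = On.decTotalOrder ≤-decTotalOrder f
    open Data.List.Sort order
    perm = sort-↭ (allFin n)
    weakly : AllPairs (λ u v → f u ≤ f v) (sort (allFin n))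
    weakly = Sorted⇒AllPairs (DecTotalOrder.totalOrder order) (sort-↗ (allFin n))
    unique : AllPairs _≢_ (sort (allFin n))
    unique = PermutationSetoid.Unique-resp-↭ (setoid (Fin n)) (↭⇒↭ₛ (↭-sym perm)) (Unique.allFin⁺ n)

  complete-isP₂ : {G : Graph n} → IsTree G → (x y : Fin n) → x ≢ y →
    (∀ u v → u ≢ v → G u v ≡ true) → Isomorphic G P₂
  complete-isP₂ {1} tree zero zero x≢y adj = contradiction refl x≢y
  complete-isP₂ {2} {G} tree x y x≢y adj = id , id , (λ _ → refl) , (λ _ → refl) , same
    where
    loopless = proj₂ (proj₁ tree)
    same : ∀ u v → P₂ u v ≡ G u v
    same zero zero = sym (loopless zero)
    same zero (suc zero) = sym (adj zero (suc zero) λ ())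
    same (suc zero) zero = sym (adj (suc zero) zero λ ())
    same (suc zero) (suc zero) = sym (loopless (suc zero))
  complete-isP₂ {suc (suc (suc n))} {G} (_ , _ , acyclic) x y x≢y adj = ⊥-elim
    -- The first three vertices form a triangle; `0` stands for cycle length 3.
    (acyclic (0 , (_↑ˡ n) , (λ {i} {j} → Fin.↑ˡ-injective n i j) ,
      (λ { zero → adj _ _ λ () ; (suc zero) → adj _ _ λ () }) , adj _ _ λ ()))

  diam-1-isP₂ : {G : Graph n} → IsTree G → Bipolar G → diam G ≤ 1 → Isomorphic G P₂
  diam-1-isP₂ {G = G} tree B diam≤1 = complete-isP₂ tree pole₁ pole₂ (λ e → opposite-poles (cong side e)) adj
    where
    open Bipolar B
    open Tree tree
    adj : ∀ u v → u ≢ v → G u v ≡ true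
    adj u v u≢v with dist G u v in eq | ≤-trans (dist-≤-diam G u v) diam≤1
    ... | zero | _ = contradiction (dist-0 sim conn eq) u≢v
    ... | suc zero | _ = dist-1 sim conn eq
    ... | suc (suc _) | s≤s ()

  record Diametral (G : Graph n) : Set where
    field
      far near : Fin n
      far≢near : far ≢ near
      near≤far : level G near ≤ level G far
      diam≤ : diam G ≤ level G far + level G near + 1

  diam-≥1 : {G : Graph n} → IsTree G → Bipolar G → 1 ≤ diam G
  diam-≥1 {G = G} tree B =
    ≤-trans (n≢0⇒n>0 λ e → opposite-poles (cong side (dist-0 sim conn e))) (dist-≤-diam G pole₁ pole₂)
    where
    open Bipolar B
    open Tree tree

  diametral : {G : Graph n} → IsTree G → Bipolar G → Diametral G
  diametral {G = G} tree B with diam-attained G (Bipolar.pole₁ B)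
  ... | u , v , d≡ with ≤-total (level G v) (level G u)
  ...   | inj₁ v≤u = record
    { far = u ; near = v ; far≢near = u≢v ; near≤far = v≤u
    ; diam≤ = ≤-trans (≤-reflexive (sym d≡)) (Bipolar.dist-≤-levels B u v) }
    where
    u≢v : u ≢ v
    u≢v refl = <⇒≢ (diam-≥1 tree B) (trans (sym (dist-refl {G = G} u)) d≡)
  ...   | inj₂ u≤v = record
    { far = v ; near = u ; far≢near = v≢u ; near≤far = u≤v
    ; diam≤ = ≤-trans (≤-reflexive (trans (sym d≡) (dist-sym (proj₁ tree) (proj₁ (proj₂ tree)) u v)))
                      (Bipolar.dist-≤-levels B v u) }
    where
    v≢u : v ≢ u
    v≢u refl = <⇒≢ (diam-≥1 tree B) (trans (sym (dist-refl {G = G} u)) d≡)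

  module TreeProduct {m n : ℕ} {T₁ : Graph m} {T₂ : Graph n} (t₁ : IsTree T₁) (t₂ : IsTree T₂)
    (B₁ : Bipolar T₁) (B₂ : Bipolar T₂) (f : Fin (m * n) → ℕ) (radio : IsRadioLabeling (T₁ □ T₂) f) where

    open Product T₁ T₂
    module B₁ = Bipolar B₁
    module B₂ = Bipolar B₂
    conn₁ = proj₁ (proj₂ t₁)
    conn₂ = proj₁ (proj₂ t₂)

    d : ℕ
    d = diam T₁ + diam T₂

    L : Fin (m * n) → ℕ
    L x = level T₁ (π₁ x) + level T₂ (π₂ x)

    D : Fin (m * n) → Fin (m * n) → ℕ
    D x y = dist T₁ (π₁ x) (π₁ y) + dist T₂ (π₂ x) (π₂ y)

    -- Diametral pairs of the factors combine to two vertices of the product at distance at least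
    -- `d`.
    d≤diam : d ≤ diam (T₁ □ T₂)
    d≤diam with diam-attained T₁ B₁.pole₁ | diam-attained T₂ B₂.pole₁
    ... | a , a′ , ea | b , b′ , eb =
      subst (_≤ diam (T₁ □ T₂)) (cong₂ _+_ ea eb) (dist-+-≤-diam-□ conn₁ conn₂ a a′ b b′)

    separated : ∀ u v → f u < f v → d + 1 + f u ≤ f v + D u v
    separated u v fu<fv = begin
      d + 1 + f u                         ≤⟨ +-monoˡ-≤ (f u) (+-monoˡ-≤ 1 d≤diam) ⟩
      diam G + 1 + f u                    ≤⟨ +-monoˡ-≤ (f u) (m≤n+m∸n (diam G + 1) (dist G u v)) ⟩
      dist G u v + (diam G + 1 ∸ dist G u v) + f u
                                          ≤⟨ +-monoˡ-≤ (f u) (+-mono-≤ (dist-□-≤ conn₁ conn₂ u v)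
                                               (radio u v λ e → <⇒≢ fu<fv (cong f e))) ⟩
      D u v + ∣ f u - f v ∣ + f u         ≡⟨ cong (λ i → D u v + i + f u) (m≤n⇒∣m-n∣≡n∸m (<⇒≤ fu<fv)) ⟩
      D u v + (f v ∸ f u) + f u           ≡⟨ +-assoc (D u v) _ _ ⟩
      D u v + (f v ∸ f u + f u)           ≡⟨ cong (D u v +_) (m∸n+n≡m (<⇒≤ fu<fv)) ⟩
      D u v + f v                         ≡⟨ +-comm (D u v) (f v) ⟩
      f v + D u v                         ∎
      where
      open ≤-Reasoning
      G = T₁ □ T₂

    -- No distance exceeds the diameter, so labels of distinct vertices differ by at least 1.
    f-injective : Injective _≡_ _≡_ f
    f-injective {u} {v} e with u Fin.≟ v
    ... | yes u≡v = u≡v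
    ... | no u≢v = contradiction
      (≤-trans (m<n⇒0<n∸m (≤-trans (s≤s (dist-≤-diam (T₁ □ T₂) u v)) (≤-reflexive (+-comm 1 _))))
               (≤-trans (radio u v u≢v) (≤-reflexive (m≡n⇒∣m-n∣≡0 e))))
      λ ()

    L-combine : ∀ a b → L (combine a b) ≡ level T₁ a + level T₂ b
    L-combine a b = cong₂ _+_ (cong (level T₁) (π₁-combine a b)) (cong (level T₂) (π₂-combine a b))

    D-combine : ∀ a b a′ b′ → D (combine a b) (combine a′ b′) ≡ dist T₁ a a′ + dist T₂ b b′
    D-combine a b a′ b′ = cong₂ _+_ (cong₂ (dist T₁) (π₁-combine a b) (π₁-combine a′ b′))
                                    (cong₂ (dist T₂) (π₂-combine a b) (π₂-combine a′ b′))

    D-sym : ∀ x y → D x y ≡ D y x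
    D-sym x y = cong₂ _+_ (dist-sym (proj₁ t₁) conn₁ _ _) (dist-sym (proj₁ t₂) conn₂ _ _)

    side₁ side₂ : Fin (m * n) → Bool
    side₁ x = B₁.side (π₁ x)
    side₂ x = B₂.side (π₂ x)

    +-regroup : ∀ a b c e i j → a + b + i + (c + e + j) ≡ a + c + (b + e) + (i + j)
    +-regroup = solve-∀

    D-≤ : ∀ x y → D x y ≤ L x + L y + 2
    D-≤ x y = ≤-trans (+-mono-≤ (B₁.dist-≤-levels (π₁ x) (π₁ y)) (B₂.dist-≤-levels (π₂ x) (π₂ y)))
      (≤-reflexive (+-regroup (level T₁ (π₁ x)) _ (level T₂ (π₂ x)) _ 1 1))

    D-≤₁ : ∀ x y → side₁ x ≡ side₁ y → D x y ≤ L x + L y + 1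
    D-≤₁ x y e = ≤-trans (+-mono-≤ (m≤n⇒m≤n+o 0 (B₁.same-side (π₁ x) (π₁ y) e))
                                   (B₂.dist-≤-levels (π₂ x) (π₂ y)))
      (≤-reflexive (+-regroup (level T₁ (π₁ x)) _ (level T₂ (π₂ x)) _ 0 1))

    D-≤₂ : ∀ x y → side₂ x ≡ side₂ y → D x y ≤ L x + L y + 1
    D-≤₂ x y e = ≤-trans (+-mono-≤ (B₁.dist-≤-levels (π₁ x) (π₁ y))
                                   (m≤n⇒m≤n+o 0 (B₂.same-side (π₂ x) (π₂ y) e)))
      (≤-reflexive (+-regroup (level T₁ (π₁ x)) _ (level T₂ (π₂ x)) _ 1 0))

    D-≤₁₂ : ∀ x y → side₁ x ≡ side₁ y → side₂ x ≡ side₂ y → D x y ≤ L x + L y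
    D-≤₁₂ x y e e′ = ≤-trans (+-mono-≤ (B₁.same-side (π₁ x) (π₁ y) e) (B₂.same-side (π₂ x) (π₂ y) e′))
      (≤-reflexive (+-interchange (level T₁ (π₁ x)) _ (level T₂ (π₂ x)) _))

    open Labeling f L D d side₁ side₂ separated D-≤ D-≤₁ D-≤₂ D-≤₁₂

    sumF-L : sumF L ≡ n * totalLevel T₁ + m * totalLevel T₂
    sumF-L = trans (sumF-combine m L)
      (trans (sumF-cong (λ a → sumF-cong (λ b → L-combine a b))) (sumF-separate m n (level T₁) (level T₂)))

    -- Exchanging the pole in the first coordinate alone changes the diagonal.
    two-diagonals : ∃₂ λ u v → diagonal u ≢ diagonal v
    two-diagonals = combine B₁.pole₁ B₂.pole₁ , combine B₁.pole₂ B₂.pole₁ , λ e →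
      B₁.opposite-poles (xor-cancelʳ _ _ (B₂.side B₂.pole₁)
        (trans (sym (at B₁.pole₁)) (trans e (at B₁.pole₂))))
      where
      at : ∀ a → diagonal (combine a B₂.pole₁) ≡ B₁.side a xor B₂.side B₂.pole₁
      at a = cong₂ _xor_ (cong B₁.side (π₁-combine a B₂.pole₁)) (cong B₂.side (π₂-combine a B₂.pole₁))

    CriticalPair : Set
    CriticalPair = ∃₂ λ a b → L a + L b + 1 ≤ D a b × (∀ v → High v → v ≡ a ⊎ v ≡ b)

    f-≤-span : ∀ x y → f x ≤ f y + span f
    f-≤-span x y = ≤-trans (≤-maxF f x) (≤-trans (m≤n+m∸n (maxF f) (minF f)) (+-monoˡ-≤ (span f) (minF-≤ f y)))

    -- Inserting `f y ≤ f x + span f` and the span equation into `telescope` cancels `q * d`, which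
    -- leaves at most 1 for the end levels and the slacks together.
    span-bound⇒critical-pair : ∀ q → m * n ≡ suc q →
      span f + (sumF L + sumF L) + q ≡ q * d + 1 → 3 ≤ d → CriticalPair
    span-bound⇒critical-pair q p≡ s≡ 3≤d with sorted-enumeration f f-injective
    ... | xs , perm , ordered = go xs perm ordered
      where
      go : ∀ xs → xs ↭ allFin (m * n) → AllPairs _≺_ xs → CriticalPair
      go [] perm _ with () ← trans (↭-length perm) (trans (length-tabulate {n = m * n} id) p≡)
      go (x ∷ ys) perm ordered = critical-pair x ys ordered
        (λ v → ∈-resp-↭ (↭-sym perm) (∈-allFin v)) small two-diagonals 3≤d
        where
        len : length ys ≡ q
        len = suc-injective (trans (↭-length perm) (trans (length-tabulate {n = m * n} id) p≡))
        total : sum (map L (x ∷ ys)) ≡ sumF L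
        total = trans (sum-↭ (map⁺ L perm)) (sum-tabulate L id)
        y = last x ys
        bound : f x + L x + L y + q * d + slacks x ys ≤ f y + (sumF L + sumF L) + q
        bound = subst₂ (λ i j → f x + L x + L y + i * d + slacks x ys ≤ f y + (j + j) + i) len total
                  (telescope x ys ordered)
        eq₁ : ∀ a p r e s → a + e + (p + r + s) ≡ a + p + r + e + s
        eq₁ = solve-∀
        eq₂ : ∀ a s t q → a + s + t + q ≡ a + (s + t + q)
        eq₂ = solve-∀
        small : L x + L y + slacks x ys ≤ 1
        small = cancel-≤ (f x + q * d)
          (≤-trans bound (+-monoˡ-≤ q (+-monoˡ-≤ (sumF L + sumF L) (f-≤-span y x))))
          (eq₁ (f x) (L x) (L y) (q * d) (slacks x ys))
          (trans (eq₂ (f x) (span f) (sumF L + sumF L) q)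
                 (trans (cong (f x +_) s≡) (sym (+-assoc (f x) (q * d) 1))))

    -- Three high vertices from diametral pairs.

    module Contradiction (pair : CriticalPair) where

      a = proj₁ pair
      b = proj₁ (proj₂ pair)
      ab = proj₁ (proj₂ (proj₂ pair))
      only = proj₂ (proj₂ (proj₂ pair))

      -- Two distinct high vertices must be `a` and `b` in some order.
      pair-≤ : ∀ {u v} → u ≢ v → High u → High v → L u + L v + 1 ≤ D u v
      pair-≤ {u} {v} u≢v hu hv with only u hu | only v hv
      ... | inj₁ refl | inj₁ refl = contradiction refl u≢v
      ... | inj₁ refl | inj₂ refl = ab
      ... | inj₂ refl | inj₁ refl = subst₂ _≤_ (cong (_+ 1) (+-comm (L a) (L b))) (D-sym a b) ab
      ... | inj₂ refl | inj₂ refl = contradiction refl u≢v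

      no-three-High : ∀ {u v w} → u ≢ v → u ≢ w → v ≢ w → High u → High v → High w → ⊥
      no-three-High {u} {v} {w} u≢v u≢w v≢w hu hv hw with only u hu | only v hv | only w hw
      ... | inj₁ p | inj₁ q | _ = u≢v (trans p (sym q))
      ... | inj₁ p | inj₂ _ | inj₁ r = u≢w (trans p (sym r))
      ... | inj₁ _ | inj₂ q | inj₂ r = v≢w (trans q (sym r))
      ... | inj₂ _ | inj₁ q | inj₁ r = v≢w (trans q (sym r))
      ... | inj₂ p | inj₁ _ | inj₂ r = u≢w (trans p (sym r))
      ... | inj₂ p | inj₂ q | _ = u≢v (trans p (sym q))

      open Diametral (diametral t₁ B₁) renaming
        (far to x; near to y; far≢near to x≢y; near≤far to y≤x; diam≤ to d₁≤)
      open Diametral (diametral t₂ B₂) renaming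
        (far to z; near to w; far≢near to z≢w; near≤far to w≤z; diam≤ to d₂≤)

      lx = level T₁ x
      ly = level T₁ y
      lz = level T₂ z
      lw = level T₂ w

      xz = combine x z
      yz = combine y z
      xw = combine x w

      High-combine : ∀ a b → d ≤ (level T₁ a + level T₂ b) + (level T₁ a + level T₂ b) + 2 → High (combine a b)
      High-combine a b h = subst (λ l → d ≤ l + l + 2) (sym (L-combine a b)) h

      -- The levels are grouped as those of `xw` and `yz`: the vertex with the larger sum is then
      -- high.
      d≤ : d ≤ (lx + lw) + (ly + lz) + 2
      d≤ = ≤-trans (+-mono-≤ d₁≤ d₂≤) (≤-reflexive (eq lx ly lz lw))
        where
        eq : ∀ a b c e → a + b + 1 + (c + e + 1) ≡ a + e + (b + c) + 2
        eq = solve-∀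

      -- Both coordinates are the deeper ends, so the level of `xz` is at least that of `xw` and
      -- that of `yz`.
      xz-High : High xz
      xz-High = High-combine x z (≤-trans d≤ (+-monoˡ-≤ 2 (+-mono-≤ (+-monoʳ-≤ lx w≤z) (+-monoˡ-≤ lz y≤x))))

      xz≢yz : xz ≢ yz
      xz≢yz e = x≢y (Fin.combine-injectiveˡ x z y z e)

      xz≢xw : xz ≢ xw
      xz≢xw e = z≢w (Fin.combine-injectiveʳ x z x w e)

      yz≢xw : yz ≢ xw
      yz≢xw e = x≢y (sym (Fin.combine-injectiveˡ y z x w e))

      -- `xz` and `yz` are then the critical pair and share `z`, so their distance is at most
      -- `lx + ly + 1`. This forces `lz`, and with it `lw`, to be 0, so `xw` has the level of `xz`.
      yz-High⇒xw-High : High yz → High xw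
      yz-High⇒xw-High h = High-combine x w
        (subst (λ i → d ≤ (lx + i) + (lx + i) + 2) lz≡lw
          (subst (λ l → d ≤ l + l + 2) (L-combine x z) xz-High))
        where
        levels≤ : (lx + lz) + (ly + lz) + 1 ≤ lx + ly + 1
        levels≤ = begin
          (lx + lz) + (ly + lz) + 1      ≡⟨ cong₂ (λ i j → i + j + 1) (L-combine x z) (L-combine y z) ⟨
          L xz + L yz + 1                ≤⟨ pair-≤ xz≢yz xz-High h ⟩
          D xz yz                        ≡⟨ D-combine x z y z ⟩
          dist T₁ x y + dist T₂ z z      ≡⟨ cong (dist T₁ x y +_) (dist-refl {G = T₂} z) ⟩
          dist T₁ x y + 0                ≡⟨ +-identityʳ _ ⟩
          dist T₁ x y                    ≤⟨ B₁.dist-≤-levels x y ⟩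
          lx + ly + 1                    ∎
          where open ≤-Reasoning
        eq : ∀ a b c → a + b + 1 + (c + c) ≡ (a + c) + (b + c) + 1
        eq = solve-∀
        lz≡0 : lz ≡ 0
        lz≡0 = m+n≡0⇒m≡0 lz (n≤0⇒n≡0 (cancel-≤ (lx + ly + 1) levels≤ (eq lx ly lz) (sym (+-identityʳ _))))
        lz≡lw : lz ≡ lw
        lz≡lw = trans lz≡0 (sym (n≤0⇒n≡0 (subst (lw ≤_) lz≡0 w≤z)))

      -- The mirror argument: `xz` and `xw` share `x`, which forces `lx` and `ly` to be 0.
      xw-High⇒yz-High : High xw → High yz
      xw-High⇒yz-High h = High-combine y z
        (subst (λ i → d ≤ (i + lz) + (i + lz) + 2) lx≡ly
          (subst (λ l → d ≤ l + l + 2) (L-combine x z) xz-High))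
        where
        levels≤ : (lx + lz) + (lx + lw) + 1 ≤ lz + lw + 1
        levels≤ = begin
          (lx + lz) + (lx + lw) + 1      ≡⟨ cong₂ (λ i j → i + j + 1) (L-combine x z) (L-combine x w) ⟨
          L xz + L xw + 1                ≤⟨ pair-≤ xz≢xw xz-High h ⟩
          D xz xw                        ≡⟨ D-combine x z x w ⟩
          dist T₁ x x + dist T₂ z w      ≡⟨ cong (_+ dist T₂ z w) (dist-refl {G = T₁} x) ⟩
          dist T₂ z w                    ≤⟨ B₂.dist-≤-levels z w ⟩
          lz + lw + 1                    ∎
          where open ≤-Reasoning
        eq : ∀ a b c → b + c + 1 + (a + a) ≡ (a + b) + (a + c) + 1
        eq = solve-∀
        lx≡0 : lx ≡ 0
        lx≡0 = m+n≡0⇒m≡0 lx (n≤0⇒n≡0 (cancel-≤ (lz + lw + 1) levels≤ (eq lx lz lw) (sym (+-identityʳ _))))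
        lx≡ly : lx ≡ ly
        lx≡ly = trans lx≡0 (sym (n≤0⇒n≡0 (subst (ly ≤_) lx≡0 y≤x)))

      absurd : ⊥
      absurd with ≤-total (lx + lw) (ly + lz)
      ... | inj₁ le = no-three-High xz≢yz xz≢xw yz≢xw xz-High yz-High (yz-High⇒xw-High yz-High)
        where
        yz-High : High yz
        yz-High = High-combine y z (≤-trans d≤ (+-monoˡ-≤ 2 (+-monoˡ-≤ (ly + lz) le)))
      ... | inj₂ ge = no-three-High xz≢yz xz≢xw yz≢xw xz-High (xw-High⇒yz-High xw-High) xw-High
        where
        xw-High : High xw
        xw-High = High-combine x w (≤-trans d≤ (+-monoˡ-≤ 2 (+-monoʳ-≤ (lx + lw) ge)))

    span-bound⇒diam-2 : ∀ q → m * n ≡ suc q →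
      span f + (sumF L + sumF L) + q ≡ q * d + 1 → d ≤ 2
    span-bound⇒diam-2 q p≡ s≡ = ≮⇒≥ λ 3≤d → Contradiction.absurd (span-bound⇒critical-pair q p≡ s≡ 3≤d)

-- The span equation and the conclusion.

open RadioLabelings

open import Data.Nat using (ℕ; suc)
import Data.Nat as ℕ
import Data.Nat.Properties as ℕ
open import Data.Integer using (ℤ; +_; _-_; _*_; _+_)
open import Data.Integer.Properties using (+-injective; pos-*)
open import Data.Integer.Tactic.RingSolver using (solve-∀)
import Data.Fin
open import Data.Product using (_×_; _,_; proj₁; proj₂)
open import Relation.Binary.PropositionalEquality

-- Moving all negative terms across gives an equation in ℕ; writing the order as `suc q` absorbs the
-- subtraction in `p - 1`.
span-equation : ∀ k q d m n L₁ L₂ →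
  + k ≡ (+ suc q - + 1) * (+ d - + 1) - + 2 * + n * + L₁ - + 2 * + m * + L₂ + + 1 →
  k ℕ.+ ((n ℕ.* L₁ ℕ.+ m ℕ.* L₂) ℕ.+ (n ℕ.* L₁ ℕ.+ m ℕ.* L₂)) ℕ.+ q ≡ q ℕ.* d ℕ.+ 1
span-equation k q d m n L₁ L₂ eq = +-injective (begin
  + k + (+ (n ℕ.* L₁) + + (m ℕ.* L₂) + (+ (n ℕ.* L₁) + + (m ℕ.* L₂))) + + q
    ≡⟨ cong₂ (λ a b → + k + (a + b + (a + b)) + + q) (pos-* n L₁) (pos-* m L₂) ⟩
  + k + (+ n * + L₁ + + m * + L₂ + (+ n * + L₁ + + m * + L₂)) + + q
    ≡⟨ cong (λ i → i + (+ n * + L₁ + + m * + L₂ + (+ n * + L₁ + + m * + L₂)) + + q) eq ⟩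
  (+ 1 + + q - + 1) * (+ d - + 1) - + 2 * + n * + L₁ - + 2 * + m * + L₂ + + 1
    + (+ n * + L₁ + + m * + L₂ + (+ n * + L₁ + + m * + L₂)) + + q
    ≡⟨ expand (+ q) (+ d) (+ m) (+ n) (+ L₁) (+ L₂) ⟩
  + q * + d + + 1
    ≡⟨ cong (_+ + 1) (pos-* q d) ⟨
  + (q ℕ.* d) + + 1 ∎)
  where
  open ≡-Reasoning
  expand : ∀ q d m n a b →
    (+ 1 + q - + 1) * (d - + 1) - + 2 * n * a - + 2 * m * b + + 1 + (n * a + m * b + (n * a + m * b)) + q
    ≡ q * d + + 1
  expand = solve-∀

theorem3p2 : ∀ {m n : ℕ} (T₁ : Graph m) (T₂ : Graph n) →
    IsTree T₁ → IsTree T₂ →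
    numWeightCenters T₁ ≡ 2 → numWeightCenters T₂ ≡ 2 →
    (k : ℕ) → IsRadioNumber (T₁ □ T₂) k →
    + k ≡ (+ (m Data.Nat.* n) - + 1) * (+ (diam T₁ Data.Nat.+ diam T₂) - + 1)
          - + 2 * + n * + totalLevel T₁ - + 2 * + m * + totalLevel T₂ + + 1 →
    Isomorphic T₁ P₂ × Isomorphic T₂ P₂
theorem3p2 {m} {n} T₁ T₂ t₁ t₂ c₁ c₂ k ((f , radio , span≡k) , _) eq =
  -- Both diameters are at least 1 and their sum is at most 2.
  diam-1-isP₂ t₁ B₁ (ℕ.+-cancelʳ-≤ 1 _ 1 (ℕ.≤-trans (ℕ.+-monoʳ-≤ (diam T₁) (diam-≥1 t₂ B₂)) d≤2)) ,
  diam-1-isP₂ t₂ B₂ (ℕ.+-cancelˡ-≤ 1 _ 1 (ℕ.≤-trans (ℕ.+-monoˡ-≤ (diam T₂) (diam-≥1 t₁ B₁)) d≤2))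
  where
  B₁ = bipolar t₁ c₁
  B₂ = bipolar t₂ c₂
  open TreeProduct t₁ t₂ B₁ B₂ f radio

  bound : ∀ p → m ℕ.* n ≡ p → d ℕ.≤ 2
  -- A pair of poles is a vertex of the product, so its order is not 0.
  bound 0 p≡ with () ← subst Data.Fin.Fin p≡ (Data.Fin.combine (Bipolar.pole₁ B₁) (Bipolar.pole₁ B₂))
  bound (suc q) p≡ = span-bound⇒diam-2 q p≡
    (trans (cong₂ (λ i j → i ℕ.+ (j ℕ.+ j) ℕ.+ q) span≡k sumF-L)
      (span-equation k q d m n (totalLevel T₁) (totalLevel T₂)
        (subst (λ p → + k ≡ (+ p - + 1) * (+ d - + 1)
          - + 2 * + n * + totalLevel T₁ - + 2 * + m * + totalLevel T₂ + + 1) p≡ eq)))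

  d≤2 : d ℕ.≤ 2
  d≤2 = bound (m ℕ.* n) refl
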